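{- Let $\mathbb{A}$ be a symmetric strict monoidal category with braiding $\sigma$, and let $\mathbf{H}\,\mathcal{C}(\mathbb{A})$ be the strict monoidal category of horizontal cells of its free cornering. For all objects $A,B$ of $\mathbb{A}$ there is a morphism $d^\circ_\bullet:A^\circ\otimes B^\bullet\to B^\bullet\otimes A^\circ$ of $\mathbf{H}\,\mathcal{C}(\mathbb{A})$, given by the vertical composite, from top to bottom, of the cells $r^\circ_A\vert r^\bullet_B$, $\ulcorner\sigma_{A,B}\urcorner$ and $s^\bullet_B\vert s^\circ_A$. However, there need not be a morphism in the other direction, and $d^\circ_\bullet$ is not in general invertible: there exist a symmetric strict monoidal category $\mathbb{A}$ and objects $A,B$ of $\mathbb{A}$ for which there is no morphism $B^\bullet\otimes A^\circ\to A^\circ\otimes B^\bullet$ in $\mathbf{H}\,\mathcal{C}(\mathbb{A})$ (so that $d^\circ_\bullet$ is not invertible). In particular, $\mathbf{H}\,\mathcal{C}(\mathbb{A})$ is monoidal but need not be symmetric.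
   Context: Single-object double categories. A single-object double category $\mathbb{D}$ consists of a monoid $(\mathbb{D}_H,\otimes,I)$ of horizontal edges, a monoid $(\mathbb{D}_V,\otimes,I)$ of vertical edges, and cells $\alpha$, each with a top and a bottom boundary in $\mathbb{D}_H$ and a left and a right boundary in $\mathbb{D}_V$. If the right boundary of $\alpha$ equals the left boundary of $\beta$ there is a horizontal composite $\alpha\vert\beta$ (top/bottom boundaries are multiplied in the order $\alpha,\beta$; left boundary that of $\alpha$, right boundary that of $\beta$). If the bottom boundary of $\alpha$ equals the top boundary of $\beta$ there is a vertical composite $\frac{\alpha}{\beta}$ (left/right boundaries multiplied in the order $\alpha,\beta$; top that of $\alpha$, bottom that of $\beta$). Both compositions are associative and unital, with identity cells $1_A$ for $A\in\mathbb{D}_H$ (top $=$ bottom $=A$, left $=$ right $=I$; identities for vertical composition) and $1_X$ for $X\in\mathbb{D}_V$ (left $=$ right $=X$, top $=$ bottom $=I$; identities for horizontal composition), with $1_A\vert 1_B=1_{A\otimes B}$, $\frac{1_X}{1_Y}=1_{X\otimes Y}$, the two identity cells on $I$ coincide, and the interchange law $\frac{\alpha}{\beta}\big\vert\frac{\gamma}{\delta}=\frac{\alpha\vert\gamma}{\beta\vert\delta}$ holds. Horizontal cells. $\mathbf{H}\mathbb{D}$ is the strict monoidal category with object set $\mathbb{D}_V$, whose morphisms $X\to Y$ are cells with left boundary $X$, right boundary $Y$ and top and bottom boundary $I$; composition is horizontal composition, and the tensor product is vertical composition, $h\otimes k=\frac{h}{k}$. Free cornering. For a symmetric strict monoidal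 category $\mathbb{A}$ (with object set $\mathbb{A}_0$ and braiding $\sigma_{A,B}:A\otimes B\to B\otimes A$), $\mathcal{C}(\mathbb{A})$ is the free single-object double category determined by: horizontal edge monoid $(\mathbb{A}_0,\otimes,I)$; vertical edge monoid the free monoid $\mathbb{A}^{\circ\bullet}=(\mathbb{A}_0\times\{\circ,\bullet\})^*$, with generators written $A^\circ$, $A^\bullet$, product written $\otimes$ and unit $I$; generating cells, for each $A\in\mathbb{A}_0$, the corners (boundaries not mentioned are $I$) - $s^\circ_A$: top $A$, right $A^\circ$; $\quad r^\circ_A$: left $A^\circ$, bottom $A$; - $s^\bullet_A$: top $A$, left $A^\bullet$; $\quad r^\bullet_A$: right $A^\bullet$, bottom $A$; and, for each morphism $f:A\to B$ of $\mathbb{A}$, a cell $\ulcorner f\urcorner$ with top $A$, bottom $B$; subject to the yanking equations $s^\circ_A\vert r^\circ_A=1_A$, $\frac{r^\circ_A}{s^\circ_A}=1_{A^\circ}$, $r^\bullet_A\vert s^\bullet_A=1_A$, $\frac{r^\bullet_A}{s^\bullet_A}=1_{A^\bullet}$, and the equations $\frac{\ulcorner f\urcorner}{\ulcorner g\urcorner}=\ulcorner f;g\urcorner$ (for composable $f,g$; $f;g$ is "first $f$ then $g$"), $\ulcorner 1_A\urcorner=1_A$, $\ulcorner f\urcorner\vert\ulcorner g\urcorner=\ulcorner f\otimes g\urcorner$. -}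

module Defs where

open import Algebra.Structures using (IsMonoid)
open import Data.List.Base using (List; []; _∷_; _++_)
open import Data.List.Properties using (++-isMonoid)
open import Data.Product.Base using (Σ-syntax; _×_; _,_)
open import Level using (Level; _⊔_; suc)
open import Relation.Binary.Bundles using (Setoid)
open import Relation.Binary.Core using (Rel)
open import Relation.Binary.PropositionalEquality
  using (_≡_; refl; sym; trans; cong; subst; subst₂)
open import Relation.Binary.Structures using (IsEquivalence)
import Relation.Binary.Reasoning.Setoid as SetoidReasoning

private
  variable
    o ℓ e h v c : Level

-- Strictness is propositional equality of objects; hom-sets are setoids, since the
-- cells of a free double category are only available as terms modulo provable
-- equality.  An equation of morphisms whose two sides have propositionally equal
-- boundaries is stated by transporting one side along the object equations.

record StrictMonoidalCategory o ℓ e : Set (suc (o ⊔ ℓ ⊔ e)) where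
  infix  4 _≈_
  infixr 6 _⨾_
  infixr 7 _⊗_ _⊗₁_
  field
    Obj      : Set o
    _⊗_      : Obj → Obj → Obj
    I        : Obj
    isMonoid : IsMonoid _≡_ _⊗_ I

    Hom     : Obj → Obj → Set ℓ
    _≈_     : ∀ {A B} → Rel (Hom A B) e
    ≈-equiv : ∀ {A B} → IsEquivalence (_≈_ {A} {B})

    id  : ∀ {A} → Hom A A
    _⨾_ : ∀ {A B C} → Hom A B → Hom B C → Hom A C
    ⨾-cong : ∀ {A B C} {f f′ : Hom A B} {g g′ : Hom B C} →
             f ≈ f′ → g ≈ g′ → f ⨾ g ≈ f′ ⨾ g′
    ⨾-assoc : ∀ {A B C D} (f : Hom A B) (g : Hom B C) (k : Hom C D) →
              (f ⨾ g) ⨾ k ≈ f ⨾ (g ⨾ k)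
    ⨾-identityˡ : ∀ {A B} (f : Hom A B) → id ⨾ f ≈ f
    ⨾-identityʳ : ∀ {A B} (f : Hom A B) → f ⨾ id ≈ f

    _⊗₁_ : ∀ {A B C D} → Hom A B → Hom C D → Hom (A ⊗ C) (B ⊗ D)
    ⊗₁-cong : ∀ {A B C D} {f f′ : Hom A B} {g g′ : Hom C D} →
              f ≈ f′ → g ≈ g′ → f ⊗₁ g ≈ f′ ⊗₁ g′
    ⊗₁-id : ∀ A B → id {A} ⊗₁ id {B} ≈ id
    ⊗₁-⨾ : ∀ {A B C A′ B′ C′} (f : Hom A B) (g : Hom B C) (f′ : Hom A′ B′) (g′ : Hom B′ C′) →
           (f ⨾ g) ⊗₁ (f′ ⨾ g′) ≈ (f ⊗₁ f′) ⨾ (g ⊗₁ g′)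

  open IsMonoid isMonoid public using (assoc; identityˡ; identityʳ)

  field
    ⊗₁-assoc : ∀ {A A′ B B′ C C′} (f : Hom A A′) (g : Hom B B′) (k : Hom C C′) →
               subst₂ Hom (assoc A B C) (assoc A′ B′ C′) ((f ⊗₁ g) ⊗₁ k) ≈ f ⊗₁ (g ⊗₁ k)
    ⊗₁-identityˡ : ∀ {A B} (f : Hom A B) →
                   subst₂ Hom (identityˡ A) (identityˡ B) (id {I} ⊗₁ f) ≈ f
    ⊗₁-identityʳ : ∀ {A B} (f : Hom A B) →
                   subst₂ Hom (identityʳ A) (identityʳ B) (f ⊗₁ id {I}) ≈ f

  IsIso : ∀ {A B} → Hom A B → Set (ℓ ⊔ e)
  IsIso {A} {B} f = Σ[ g ∈ Hom B A ] (f ⨾ g ≈ id) × (g ⨾ f ≈ id)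

-- The second hexagon and σ A I ≈ id follow from these axioms.

record Symmetry (𝕄 : StrictMonoidalCategory o ℓ e) : Set (o ⊔ ℓ ⊔ e) where
  open StrictMonoidalCategory 𝕄
  field
    σ : ∀ A B → Hom (A ⊗ B) (B ⊗ A)
    σ-natural : ∀ {A A′ B B′} (f : Hom A A′) (g : Hom B B′) →
                (f ⊗₁ g) ⨾ σ A′ B′ ≈ σ A B ⨾ (g ⊗₁ f)
    σ-involutive : ∀ A B → σ A B ⨾ σ B A ≈ id
    σ-hexagon : ∀ A B C →
      σ A (B ⊗ C) ≈ subst₂ Hom (assoc A B C) (assoc B A C) (σ A B ⊗₁ id)
                  ⨾ subst (Hom (B ⊗ (A ⊗ C))) (sym (assoc B C A)) (id ⊗₁ σ A C)

record SymmetricStrictMonoidalCategory o ℓ e : Set (suc (o ⊔ ℓ ⊔ e)) where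
  field
    strictMonoidalCategory : StrictMonoidalCategory o ℓ e
    symmetry               : Symmetry strictMonoidalCategory
  open StrictMonoidalCategory strictMonoidalCategory public
  open Symmetry symmetry public

-- Cell T B L R is the type of cells with top T, bottom B, left L and right R.

module _ {H : Set h} {V : Set v} (Cell : H → H → V → V → Set c) where

  castCell : ∀ {T T′ B B′ L L′ R R′} → T ≡ T′ → B ≡ B′ → L ≡ L′ → R ≡ R′ →
             Cell T B L R → Cell T′ B′ L′ R′
  castCell refl refl refl refl α = α

record SingleObjectDoubleCategory h v c e : Set (suc (h ⊔ v ⊔ c ⊔ e)) where
  infix  4 _≈_
  infixl 6 _∣_
  infixl 7 _/_
  infixr 8 _⊗ᴴ_ _⊗ⱽ_
  field
    H : Set h
    _⊗ᴴ_ : H → H → H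
    Iᴴ : H
    isMonoidᴴ : IsMonoid _≡_ _⊗ᴴ_ Iᴴ

    V : Set v
    _⊗ⱽ_ : V → V → V
    Iⱽ : V
    isMonoidⱽ : IsMonoid _≡_ _⊗ⱽ_ Iⱽ

    Cell : H → H → V → V → Set c
    _≈_ : ∀ {T B L R} → Rel (Cell T B L R) e
    ≈-equiv : ∀ {T B L R} → IsEquivalence (_≈_ {T} {B} {L} {R})

    -- α / β is the vertical composite, with α above β.
    _∣_ : ∀ {T T′ B B′ L M R} → Cell T B L M → Cell T′ B′ M R → Cell (T ⊗ᴴ T′) (B ⊗ᴴ B′) L R
    _/_ : ∀ {T M B L L′ R R′} → Cell T M L R → Cell M B L′ R′ → Cell T B (L ⊗ⱽ L′) (R ⊗ⱽ R′)
    1ᴴ : ∀ A → Cell A A Iⱽ Iⱽ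
    1ⱽ : ∀ X → Cell Iᴴ Iᴴ X X

    ∣-cong : ∀ {T T′ B B′ L M R} {α α′ : Cell T B L M} {β β′ : Cell T′ B′ M R} →
             α ≈ α′ → β ≈ β′ → α ∣ β ≈ α′ ∣ β′
    /-cong : ∀ {T M B L L′ R R′} {α α′ : Cell T M L R} {β β′ : Cell M B L′ R′} →
             α ≈ α′ → β ≈ β′ → α / β ≈ α′ / β′

  module Mᴴ = IsMonoid isMonoidᴴ
  module Mⱽ = IsMonoid isMonoidⱽ

  cast : ∀ {T T′ B B′ L L′ R R′} → T ≡ T′ → B ≡ B′ → L ≡ L′ → R ≡ R′ →
         Cell T B L R → Cell T′ B′ L′ R′
  cast = castCell Cell

  field
    ∣-assoc : ∀ {T T′ T″ B B′ B″ L M N R}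
              (α : Cell T B L M) (β : Cell T′ B′ M N) (γ : Cell T″ B″ N R) →
              cast (Mᴴ.assoc T T′ T″) (Mᴴ.assoc B B′ B″) refl refl ((α ∣ β) ∣ γ) ≈ α ∣ (β ∣ γ)
    ∣-identityˡ : ∀ {T B L R} (α : Cell T B L R) →
                  cast (Mᴴ.identityˡ T) (Mᴴ.identityˡ B) refl refl (1ⱽ L ∣ α) ≈ α
    ∣-identityʳ : ∀ {T B L R} (α : Cell T B L R) →
                  cast (Mᴴ.identityʳ T) (Mᴴ.identityʳ B) refl refl (α ∣ 1ⱽ R) ≈ α

    /-assoc : ∀ {T M N B L L′ L″ R R′ R″}
              (α : Cell T M L R) (β : Cell M N L′ R′) (γ : Cell N B L″ R″) →
              cast refl refl (Mⱽ.assoc L L′ L″) (Mⱽ.assoc R R′ R″) ((α / β) / γ) ≈ α / (β / γ)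
    /-identityˡ : ∀ {T B L R} (α : Cell T B L R) →
                  cast refl refl (Mⱽ.identityˡ L) (Mⱽ.identityˡ R) (1ᴴ T / α) ≈ α
    /-identityʳ : ∀ {T B L R} (α : Cell T B L R) →
                  cast refl refl (Mⱽ.identityʳ L) (Mⱽ.identityʳ R) (α / 1ᴴ B) ≈ α

    1ᴴ-∣ : ∀ A B → 1ᴴ A ∣ 1ᴴ B ≈ 1ᴴ (A ⊗ᴴ B)
    1ⱽ-/ : ∀ X Y → 1ⱽ X / 1ⱽ Y ≈ 1ⱽ (X ⊗ⱽ Y)
    1ᴴ≈1ⱽ : 1ᴴ Iᴴ ≈ 1ⱽ Iⱽ

    interchange : ∀ {T₁ T₂ M₁ M₂ B₁ B₂ L L′ N N′ R R′}
                  (α : Cell T₁ M₁ L N) (β : Cell M₁ B₁ L′ N′)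
                  (γ : Cell T₂ M₂ N R) (δ : Cell M₂ B₂ N′ R′) →
                  (α / β) ∣ (γ / δ) ≈ (α ∣ γ) / (β ∣ δ)

module HorizontalCells (𝔻 : SingleObjectDoubleCategory h v c e) where
  open SingleObjectDoubleCategory 𝔻

  I⊗I≡I : Iᴴ ⊗ᴴ Iᴴ ≡ Iᴴ
  I⊗I≡I = Mᴴ.identityˡ Iᴴ

  -- A horizontal composite of horizontal cells has top and bottom I ⊗ I, so it is
  -- retyped along I ⊗ I ≡ I.
  retype : ∀ {X Y} → Cell (Iᴴ ⊗ᴴ Iᴴ) (Iᴴ ⊗ᴴ Iᴴ) X Y → Cell Iᴴ Iᴴ X Y
  retype = cast I⊗I≡I I⊗I≡I refl refl

  private
    S : H → H → V → V → Setoid c e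
    S T B L R = record { isEquivalence = ≈-equiv {T} {B} {L} {R} }

    module E {T B L R} = IsEquivalence (≈-equiv {T} {B} {L} {R})

    cast-resp : ∀ {T T′ B B′ L L′ R R′} (p : T ≡ T′) (q : B ≡ B′) (r : L ≡ L′) (s : R ≡ R′)
                {α β : Cell T B L R} → α ≈ β → cast p q r s α ≈ cast p q r s β
    cast-resp refl refl refl refl eq = eq

    cast-irr : ∀ {T T′ B B′ L R} (p p′ : T ≡ T′) (q q′ : B ≡ B′) (α : Cell T B L R) →
               cast p q refl refl α ≡ cast p′ q′ refl refl α
    cast-irr refl refl refl refl α = refl

    cast-cast : ∀ {T T′ T″ B B′ B″ L R}
                (p : T ≡ T′) (p′ : T′ ≡ T″) (q : B ≡ B′) (q′ : B′ ≡ B″) (α : Cell T B L R) →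
                cast p′ q′ refl refl (cast p q refl refl α) ≡
                cast (trans p p′) (trans q q′) refl refl α
    cast-cast refl refl refl refl α = refl

    cast-∣ˡ : ∀ {T T₁ T′ B B₁ B′ L M R} (p : T ≡ T₁) (q : B ≡ B₁)
              (α : Cell T B L M) (β : Cell T′ B′ M R) →
              cast p q refl refl α ∣ β ≡
              cast (cong (_⊗ᴴ T′) p) (cong (_⊗ᴴ B′) q) refl refl (α ∣ β)
    cast-∣ˡ refl refl α β = refl

    cast-∣ʳ : ∀ {T T₁ T′ B B₁ B′ L M R} (p : T ≡ T₁) (q : B ≡ B₁)
              (α : Cell T′ B′ L M) (β : Cell T B M R) →
              α ∣ cast p q refl refl β ≡
              cast (cong (T′ ⊗ᴴ_) p) (cong (B′ ⊗ᴴ_) q) refl refl (α ∣ β)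
    cast-∣ʳ refl refl α β = refl

    cast-/ : ∀ {T T₁ M M₁ B B₁ L L′ R R′} (p : T ≡ T₁) (q : M ≡ M₁) (r : B ≡ B₁)
             (α : Cell T M L R) (β : Cell M B L′ R′) →
             cast p q refl refl α / cast q r refl refl β ≡ cast p r refl refl (α / β)
    cast-/ refl refl refl α β = refl

    subst₂-cast : ∀ {X X′ Y Y′} (p : X ≡ X′) (q : Y ≡ Y′) (α : Cell Iᴴ Iᴴ X Y) →
                  subst₂ (Cell Iᴴ Iᴴ) p q α ≡ cast refl refl p q α
    subst₂-cast refl refl α = refl

    retype-assoc : ∀ {W X Y Z} (α : Cell Iᴴ Iᴴ W X) (β : Cell Iᴴ Iᴴ X Y) (γ : Cell Iᴴ Iᴴ Y Z) →
                   retype (retype (α ∣ β) ∣ γ) ≈ retype (α ∣ retype (β ∣ γ))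
    retype-assoc α β γ = begin
      retype (retype (α ∣ β) ∣ γ)
        ≡⟨ cong retype (cast-∣ˡ u u (α ∣ β) γ) ⟩
      retype (cast (cong (_⊗ᴴ Iᴴ) u) (cong (_⊗ᴴ Iᴴ) u) refl refl (α ∣ β ∣ γ))
        ≡⟨ cast-cast (cong (_⊗ᴴ Iᴴ) u) u (cong (_⊗ᴴ Iᴴ) u) u (α ∣ β ∣ γ) ⟩
      cast (trans (cong (_⊗ᴴ Iᴴ) u) u) (trans (cong (_⊗ᴴ Iᴴ) u) u) refl refl (α ∣ β ∣ γ)
        ≡⟨ cast-irr _ _ _ _ (α ∣ β ∣ γ) ⟩
      cast (trans a w) (trans a w) refl refl (α ∣ β ∣ γ)
        ≡⟨ cast-cast a w a w (α ∣ β ∣ γ) ⟨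
      cast w w refl refl (cast a a refl refl (α ∣ β ∣ γ))
        ≈⟨ cast-resp w w refl refl (∣-assoc α β γ) ⟩
      cast w w refl refl (α ∣ (β ∣ γ))
        ≡⟨ cast-cast (cong (Iᴴ ⊗ᴴ_) u) u (cong (Iᴴ ⊗ᴴ_) u) u (α ∣ (β ∣ γ)) ⟨
      retype (cast (cong (Iᴴ ⊗ᴴ_) u) (cong (Iᴴ ⊗ᴴ_) u) refl refl (α ∣ (β ∣ γ)))
        ≡⟨ cong retype (cast-∣ʳ u u α (β ∣ γ)) ⟨
      retype (α ∣ retype (β ∣ γ)) ∎
      where
      open SetoidReasoning (S _ _ _ _)
      u = I⊗I≡I
      a = Mᴴ.assoc Iᴴ Iᴴ Iᴴ
      w = trans (cong (Iᴴ ⊗ᴴ_) u) u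

    retype-identityʳ : ∀ {X Y} (α : Cell Iᴴ Iᴴ X Y) → retype (α ∣ 1ⱽ Y) ≈ α
    retype-identityʳ α =
      E.trans (E.reflexive (cast-irr I⊗I≡I (Mᴴ.identityʳ Iᴴ) I⊗I≡I (Mᴴ.identityʳ Iᴴ) (α ∣ 1ⱽ _)))
              (∣-identityʳ α)

    retype-interchange : ∀ {X Y Z X′ Y′ Z′}
      (α : Cell Iᴴ Iᴴ X Y) (γ : Cell Iᴴ Iᴴ Y Z) (β : Cell Iᴴ Iᴴ X′ Y′) (δ : Cell Iᴴ Iᴴ Y′ Z′) →
      retype (α ∣ γ) / retype (β ∣ δ) ≈ retype ((α / β) ∣ (γ / δ))
    retype-interchange α γ β δ =
      E.trans (E.reflexive (cast-/ I⊗I≡I I⊗I≡I I⊗I≡I (α ∣ γ) (β ∣ δ)))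
              (E.sym (cast-resp I⊗I≡I I⊗I≡I refl refl (interchange α β γ δ)))

    subst₂-assoc : ∀ {W X Y W′ X′ Y′}
      (α : Cell Iᴴ Iᴴ W W′) (β : Cell Iᴴ Iᴴ X X′) (γ : Cell Iᴴ Iᴴ Y Y′) →
      subst₂ (Cell Iᴴ Iᴴ) (Mⱽ.assoc W X Y) (Mⱽ.assoc W′ X′ Y′) ((α / β) / γ) ≈ α / (β / γ)
    subst₂-assoc {W} {X} {Y} {W′} {X′} {Y′} α β γ =
      E.trans (E.reflexive (subst₂-cast (Mⱽ.assoc W X Y) (Mⱽ.assoc W′ X′ Y′) ((α / β) / γ)))
              (/-assoc α β γ)

    subst₂-identityˡ : ∀ {X Y} (α : Cell Iᴴ Iᴴ X Y) →
      subst₂ (Cell Iᴴ Iᴴ) (Mⱽ.identityˡ X) (Mⱽ.identityˡ Y) (1ⱽ Iⱽ / α) ≈ α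
    subst₂-identityˡ {X} {Y} α =
      E.trans (E.reflexive (subst₂-cast (Mⱽ.identityˡ X) (Mⱽ.identityˡ Y) (1ⱽ Iⱽ / α)))
        (E.trans (cast-resp refl refl (Mⱽ.identityˡ X) (Mⱽ.identityˡ Y)
                            (/-cong (E.sym 1ᴴ≈1ⱽ) E.refl))
                 (/-identityˡ α))

    subst₂-identityʳ : ∀ {X Y} (α : Cell Iᴴ Iᴴ X Y) →
      subst₂ (Cell Iᴴ Iᴴ) (Mⱽ.identityʳ X) (Mⱽ.identityʳ Y) (α / 1ⱽ Iⱽ) ≈ α
    subst₂-identityʳ {X} {Y} α =
      E.trans (E.reflexive (subst₂-cast (Mⱽ.identityʳ X) (Mⱽ.identityʳ Y) (α / 1ⱽ Iⱽ)))
        (E.trans (cast-resp refl refl (Mⱽ.identityʳ X) (Mⱽ.identityʳ Y)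
                            (/-cong E.refl (E.sym 1ᴴ≈1ⱽ)))
                 (/-identityʳ α))

  𝐇 : StrictMonoidalCategory v c e
  𝐇 = record
    { Obj = V
    ; _⊗_ = _⊗ⱽ_
    ; I = Iⱽ
    ; isMonoid = isMonoidⱽ
    ; Hom = Cell Iᴴ Iᴴ
    ; _≈_ = _≈_
    ; ≈-equiv = ≈-equiv
    ; id = 1ⱽ _
    ; _⨾_ = λ α β → retype (α ∣ β)
    ; ⨾-cong = λ p q → cast-resp I⊗I≡I I⊗I≡I refl refl (∣-cong p q)
    ; ⨾-assoc = retype-assoc
    ; ⨾-identityˡ = ∣-identityˡ
    ; ⨾-identityʳ = retype-identityʳ
    ; _⊗₁_ = _/_
    ; ⊗₁-cong = /-cong
    ; ⊗₁-id = 1ⱽ-/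
    ; ⊗₁-⨾ = retype-interchange
    ; ⊗₁-assoc = subst₂-assoc
    ; ⊗₁-identityˡ = subst₂-identityˡ
    ; ⊗₁-identityʳ = subst₂-identityʳ
    }

data Polarity : Set where
  ○ ● : Polarity

module FreeCornering (𝔸 : SymmetricStrictMonoidalCategory o ℓ e) where
  private module 𝔸 = SymmetricStrictMonoidalCategory 𝔸
  open 𝔸 using (Obj; Hom; _⊗_; I)

  Exchange : Set o
  Exchange = List (Obj × Polarity)

  infix 9 _° _•
  _° _• : Obj → Exchange
  A ° = (A , ○) ∷ []
  A • = (A , ●) ∷ []

  infixl 6 _∣_
  infixl 7 _/_

  data Cell : Obj → Obj → Exchange → Exchange → Set (o ⊔ ℓ) where
    s° : ∀ A → Cell A I [] (A °)
    r° : ∀ A → Cell I A (A °) []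
    s• : ∀ A → Cell A I (A •) []
    r• : ∀ A → Cell I A [] (A •)
    ⌜_⌝ : ∀ {A B} → Hom A B → Cell A B [] []
    1ᴴ : ∀ A → Cell A A [] []
    1ⱽ : ∀ X → Cell I I X X
    _∣_ : ∀ {T T′ B B′ L M R} → Cell T B L M → Cell T′ B′ M R → Cell (T ⊗ T′) (B ⊗ B′) L R
    _/_ : ∀ {T M B L L′ R R′} → Cell T M L R → Cell M B L′ R′ → Cell T B (L ++ L′) (R ++ R′)

  private
    cast : ∀ {T T′ B B′ L L′ R R′} → T ≡ T′ → B ≡ B′ → L ≡ L′ → R ≡ R′ →
           Cell T B L R → Cell T′ B′ L′ R′
    cast = castCell Cell
    module Mⱽ = IsMonoid (++-isMonoid {A = Obj × Polarity})

  infix 4 _≈_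

  -- The least congruence containing the axioms of a single-object double category and
  -- the equations imposed on the generators.
  data _≈_ : ∀ {T B L R} → Cell T B L R → Cell T B L R → Set (o ⊔ ℓ ⊔ e) where
    ≈-refl  : ∀ {T B L R} {α : Cell T B L R} → α ≈ α
    ≈-sym   : ∀ {T B L R} {α β : Cell T B L R} → α ≈ β → β ≈ α
    ≈-trans : ∀ {T B L R} {α β γ : Cell T B L R} → α ≈ β → β ≈ γ → α ≈ γ
    ∣-cong : ∀ {T T′ B B′ L M R} {α α′ : Cell T B L M} {β β′ : Cell T′ B′ M R} →
             α ≈ α′ → β ≈ β′ → α ∣ β ≈ α′ ∣ β′
    /-cong : ∀ {T M B L L′ R R′} {α α′ : Cell T M L R} {β β′ : Cell M B L′ R′} →
             α ≈ α′ → β ≈ β′ → α / β ≈ α′ / β′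

    ∣-assoc : ∀ {T T′ T″ B B′ B″ L M N R}
              (α : Cell T B L M) (β : Cell T′ B′ M N) (γ : Cell T″ B″ N R) →
              cast (𝔸.assoc T T′ T″) (𝔸.assoc B B′ B″) refl refl ((α ∣ β) ∣ γ) ≈ α ∣ (β ∣ γ)
    ∣-identityˡ : ∀ {T B L R} (α : Cell T B L R) →
                  cast (𝔸.identityˡ T) (𝔸.identityˡ B) refl refl (1ⱽ L ∣ α) ≈ α
    ∣-identityʳ : ∀ {T B L R} (α : Cell T B L R) →
                  cast (𝔸.identityʳ T) (𝔸.identityʳ B) refl refl (α ∣ 1ⱽ R) ≈ α
    /-assoc : ∀ {T M N B L L′ L″ R R′ R″}
              (α : Cell T M L R) (β : Cell M N L′ R′) (γ : Cell N B L″ R″) →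
              cast refl refl (Mⱽ.assoc L L′ L″) (Mⱽ.assoc R R′ R″) ((α / β) / γ) ≈ α / (β / γ)
    /-identityˡ : ∀ {T B L R} (α : Cell T B L R) →
                  cast refl refl (Mⱽ.identityˡ L) (Mⱽ.identityˡ R) (1ᴴ T / α) ≈ α
    /-identityʳ : ∀ {T B L R} (α : Cell T B L R) →
                  cast refl refl (Mⱽ.identityʳ L) (Mⱽ.identityʳ R) (α / 1ᴴ B) ≈ α
    1ᴴ-∣ : ∀ A B → 1ᴴ A ∣ 1ᴴ B ≈ 1ᴴ (A ⊗ B)
    1ⱽ-/ : ∀ X Y → 1ⱽ X / 1ⱽ Y ≈ 1ⱽ (X ++ Y)
    1ᴴ≈1ⱽ : 1ᴴ I ≈ 1ⱽ []
    interchange : ∀ {T₁ T₂ M₁ M₂ B₁ B₂ L L′ N N′ R R′}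
                  (α : Cell T₁ M₁ L N) (β : Cell M₁ B₁ L′ N′)
                  (γ : Cell T₂ M₂ N R) (δ : Cell M₂ B₂ N′ R′) →
                  (α / β) ∣ (γ / δ) ≈ (α ∣ γ) / (β ∣ δ)

    yank-∣° : ∀ A → cast (𝔸.identityʳ A) (𝔸.identityˡ A) refl refl (s° A ∣ r° A) ≈ 1ᴴ A
    yank-/° : ∀ A → r° A / s° A ≈ 1ⱽ (A °)
    yank-∣• : ∀ A → cast (𝔸.identityˡ A) (𝔸.identityʳ A) refl refl (r• A ∣ s• A) ≈ 1ᴴ A
    yank-/• : ∀ A → r• A / s• A ≈ 1ⱽ (A •)

    ⌜⌝-cong : ∀ {A B} {f g : Hom A B} → f 𝔸.≈ g → ⌜ f ⌝ ≈ ⌜ g ⌝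
    ⌜⌝-⨾ : ∀ {A B C} (f : Hom A B) (g : Hom B C) → ⌜ f ⌝ / ⌜ g ⌝ ≈ ⌜ f 𝔸.⨾ g ⌝
    ⌜⌝-id : ∀ A → ⌜ 𝔸.id {A} ⌝ ≈ 1ᴴ A
    ⌜⌝-⊗ : ∀ {A B C D} (f : Hom A B) (g : Hom C D) → ⌜ f ⌝ ∣ ⌜ g ⌝ ≈ ⌜ f 𝔸.⊗₁ g ⌝

  𝒞 : SingleObjectDoubleCategory o o (o ⊔ ℓ) (o ⊔ ℓ ⊔ e)
  𝒞 = record
    { H = Obj
    ; _⊗ᴴ_ = _⊗_
    ; Iᴴ = I
    ; isMonoidᴴ = 𝔸.isMonoid
    ; V = Exchange
    ; _⊗ⱽ_ = _++_
    ; Iⱽ = []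
    ; isMonoidⱽ = ++-isMonoid
    ; Cell = Cell
    ; _≈_ = _≈_
    ; ≈-equiv = record { refl = ≈-refl ; sym = ≈-sym ; trans = ≈-trans }
    ; _∣_ = _∣_
    ; _/_ = _/_
    ; 1ᴴ = 1ᴴ
    ; 1ⱽ = 1ⱽ
    ; ∣-cong = ∣-cong
    ; /-cong = /-cong
    ; ∣-assoc = ∣-assoc
    ; ∣-identityˡ = ∣-identityˡ
    ; ∣-identityʳ = ∣-identityʳ
    ; /-assoc = /-assoc
    ; /-identityˡ = /-identityˡ
    ; /-identityʳ = /-identityʳ
    ; 1ᴴ-∣ = 1ᴴ-∣
    ; 1ⱽ-/ = 1ⱽ-/
    ; 1ᴴ≈1ⱽ = 1ᴴ≈1ⱽ
    ; interchange = interchange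
    }

  open HorizontalCells 𝒞 using (retype)

  𝐇𝒞 : StrictMonoidalCategory o (o ⊔ ℓ) (o ⊔ ℓ ⊔ e)
  𝐇𝒞 = HorizontalCells.𝐇 𝒞

  -- The composite has top and bottom I ⊗ I.
  Is-d°• : ∀ A B → StrictMonoidalCategory.Hom 𝐇𝒞 (A ° ++ B •) (B • ++ A °) → Set (o ⊔ ℓ ⊔ e)
  Is-d°• A B d = d ≈ retype ((r° A ∣ r• B) / ⌜ 𝔸.σ A B ⌝ / (s• B ∣ s° A))

{-# OPTIONS --safe #-}
-- Let 𝔸 be the ordered monoid (ℕ, +, ≤).  On the poset ℕ, truncated subtraction
-- _∸ a is left adjoint to _+ a.  Let A act by _+ a, A° by _∸ a and A• by _+ a: then each
-- cell with boundaries T, B, L, R yields the inequality "T followed by R is at most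
-- L followed by B", because the corners do and such squares paste in both directions.
-- A cell B• ⊗ A° → A° ⊗ B• would give (n ∸ a) + b ≤ (n + b) ∸ a for all n, which fails
-- for n = 0 and a = b = 1.
module Submission where

open import Data.List.Base using ([]; _∷_; _++_; foldl)
open import Data.List.Properties using (foldl-++)
open import Data.Nat.Base using (ℕ; _+_; _∸_; _≤_)
open import Data.Nat.Properties
open import Data.Product.Base using (Σ-syntax; _×_; _,_)
open import Data.Unit.Base using (⊤)
open import Level using (0ℓ)
open import Relation.Binary.PropositionalEquality using (sym; trans; cong)
open import Relation.Nullary.Negation.Core using (¬_)
open import Defs

-- Parallel morphisms are all identified, so the omitted laws are inhabitants of `⊤`, filled in by
-- eta.
ℕ-strictMonoidalCategory : StrictMonoidalCategory 0ℓ 0ℓ 0ℓ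
ℕ-strictMonoidalCategory = record
  { Obj = ℕ
  ; _⊗_ = _+_
  ; I = 0
  ; isMonoid = +-0-isMonoid
  ; Hom = _≤_
  ; _≈_ = λ _ _ → ⊤
  ; id = ≤-refl
  ; _⨾_ = ≤-trans
  ; _⊗₁_ = +-mono-≤
  }

ℕ-symmetricStrictMonoidalCategory : SymmetricStrictMonoidalCategory 0ℓ 0ℓ 0ℓ
ℕ-symmetricStrictMonoidalCategory = record
  { strictMonoidalCategory = ℕ-strictMonoidalCategory
  ; symmetry = record { σ = λ a b → ≤-reflexive (+-comm a b) }
  }

module _ where
  open FreeCornering ℕ-symmetricStrictMonoidalCategory
  open StrictMonoidalCategory 𝐇𝒞 using () renaming (Hom to HorizontalCell)

  step : ℕ → ℕ × Polarity → ℕ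
  step n (a , ○) = n ∸ a
  step n (a , ●) = n + a

  step-mono : ∀ x {m n} → m ≤ n → step m x ≤ step n x
  step-mono (a , ○) = ∸-monoˡ-≤ a
  step-mono (a , ●) = +-monoˡ-≤ a

  act : Exchange → ℕ → ℕ
  act X n = foldl step n X

  act-mono : ∀ X {m n} → m ≤ n → act X m ≤ act X n
  act-mono []      m≤n = m≤n
  act-mono (x ∷ X) m≤n = act-mono X (step-mono x m≤n)

  open ≤-Reasoning

  -- Induction on the cell. Pasting needs all `n` at once: `β` is used at `n + T` in `α ∣ β` and at
  -- `act L n` in `α / β`.
  cell⇒≤ : ∀ {T B L R} → Cell T B L R → ∀ n → act R (n + T) ≤ act L n + B
  cell⇒≤ (s° a) n = ≤-reflexive (trans (m+n∸n≡m n a) (sym (+-identityʳ n)))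
  cell⇒≤ (r° a) n = begin
    n + 0        ≡⟨ +-identityʳ n ⟩
    -- The unit of the adjunction; the case of `s°` is its counit.
    n            ≤⟨ m≤n+m∸n n a ⟩
    a + (n ∸ a)  ≡⟨ +-comm a (n ∸ a) ⟩
    (n ∸ a) + a  ∎
  cell⇒≤ (s• a) n = ≤-reflexive (sym (+-identityʳ (n + a)))
  cell⇒≤ (r• a) n = ≤-reflexive (cong (_+ a) (+-identityʳ n))
  cell⇒≤ ⌜ a≤b ⌝ n = +-monoʳ-≤ n a≤b
  cell⇒≤ (1ᴴ a) n = ≤-refl
  cell⇒≤ (1ⱽ X) n = ≤-reflexive (trans (cong (act X) (+-identityʳ n)) (sym (+-identityʳ (act X n))))
  cell⇒≤ (_∣_ {T} {T′} {B} {B′} {L} {M} {R} α β) n = begin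
    act R (n + (T + T′))   ≡⟨ cong (act R) (+-assoc n T T′) ⟨
    act R ((n + T) + T′)   ≤⟨ cell⇒≤ β (n + T) ⟩
    act M (n + T) + B′     ≤⟨ +-monoˡ-≤ B′ (cell⇒≤ α n) ⟩
    (act L n + B) + B′     ≡⟨ +-assoc (act L n) B B′ ⟩
    act L n + (B + B′)     ∎
  cell⇒≤ (_/_ {T} {M} {B} {L} {L′} {R} {R′} α β) n = begin
    act (R ++ R′) (n + T)     ≡⟨ foldl-++ step (n + T) R R′ ⟩
    act R′ (act R (n + T))    ≤⟨ act-mono R′ (cell⇒≤ α n) ⟩
    act R′ (act L n + M)      ≤⟨ cell⇒≤ β (act L n) ⟩
    act L′ (act L n) + B      ≡⟨ cong (_+ B) (foldl-++ step n L L′) ⟨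
    act (L ++ L′) n + B       ∎

  no-reverse-swap : ¬ HorizontalCell (1 • ++ 1 °) (1 ° ++ 1 •)
  -- Truncation makes the right boundary send 0 to 1, while the left sends it to 0: the inequality
  -- computes to `1 ≤ 0`.
  no-reverse-swap α with cell⇒≤ α 0
  ... | ()

  no-symmetry : ¬ Symmetry 𝐇𝒞
  no-symmetry symmetry = no-reverse-swap (Symmetry.σ symmetry (1 •) (1 °))

mainTheorem6 : ∀ {o ℓ e} →
    ((𝔸 : SymmetricStrictMonoidalCategory o ℓ e) (A B : SymmetricStrictMonoidalCategory.Obj 𝔸) →
      let open FreeCornering 𝔸
          open StrictMonoidalCategory 𝐇𝒞
      in Σ[ d ∈ Hom (A ° ⊗ B •) (B • ⊗ A °) ] Is-d°• A B d)
    ×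
    (Σ[ 𝔸 ∈ SymmetricStrictMonoidalCategory 0ℓ 0ℓ 0ℓ ]
      let open FreeCornering 𝔸
          open StrictMonoidalCategory 𝐇𝒞
      in (Σ[ A ∈ SymmetricStrictMonoidalCategory.Obj 𝔸 ] Σ[ B ∈ SymmetricStrictMonoidalCategory.Obj 𝔸 ]
            (¬ Hom (B • ⊗ A °) (A ° ⊗ B •))
            × (∀ (d : Hom (A ° ⊗ B •) (B • ⊗ A °)) → Is-d°• A B d → ¬ IsIso d))
         × ¬ Symmetry 𝐇𝒞)
mainTheorem6 =
  -- Reflexivity forces the witness to be the defining composite, whose boundaries agree by
  -- computation.
  (λ 𝔸 A B → _ , FreeCornering.≈-refl {𝔸 = 𝔸}) ,
  ℕ-symmetricStrictMonoidalCategory ,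
  (1 , 1 , no-reverse-swap , λ _ _ (d⁻¹ , _) → no-reverse-swap d⁻¹) ,
  no-symmetry
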